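{- For every integer $n\ge 1$, the sequence of denominators of the fractions in the Farey sequence $F_n$, taken in the order in which the fractions appear in $F_n$, is a palindrome. That is, if $F_n = \left(\frac{a_1}{b_1},\frac{a_2}{b_2},\ldots,\frac{a_m}{b_m}\right)$ with $\frac{a_1}{b_1}<\frac{a_2}{b_2}<\cdots<\frac{a_m}{b_m}$ and every fraction in reduced form, then $b_i = b_{m+1-i}$ for all $1\le i\le m$.
   Context: For an integer $n\ge 1$, the Farey sequence $F_n$ (in the interval $[0,1]$) is the increasing finite sequence of all rational numbers in $[0,1]$ which, written in reduced form $\frac{a}{b}$ (with $a \ge 0$, $b\ge 1$, $\gcd(a,b)=1$), have denominator $b \le n$. It starts at $\frac{0}{1}$ and ends at $\frac{1}{1}$. A sequence is called a palindrome if it reads the same forward and backward. -}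

module Defs where

open import Data.Fin.Base using (zero; suc; opposite) renaming (_<_ to _<ᶠ_)
open import Data.Integer.Base as ℤ using (+_)
import Data.Integer.Properties as ℤ
open import Data.List.Base using (List; _∷_; length; lookup; filter; upTo; cartesianProductWith; deduplicate)
open import Data.List.Membership.Propositional using (_∈_)
open import Data.List.Membership.Propositional.Properties
  using (∈-lookup; ∈-filter⁺; ∈-filter⁻; ∈-deduplicate⁺; ∈-deduplicate⁻; ∈-upTo⁺; ∈-cartesianProductWith⁺)
open import Data.List.Relation.Binary.Permutation.Propositional using (↭-sym; ↭⇒↭ₛ)
open import Data.List.Relation.Binary.Permutation.Propositional.Properties using (∈-resp-↭)
import Data.List.Relation.Binary.Permutation.Setoid.Properties as Permutation
import Data.List.Relation.Unary.All as All
open import Data.List.Relation.Unary.AllPairs as AllPairs using (AllPairs; _∷_)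
open import Data.List.Relation.Unary.Any using (index)
open import Data.List.Relation.Unary.Any.Properties using (lookup-index)
open import Data.List.Relation.Unary.Linked.Properties using (Linked⇒AllPairs)
import Data.List.Relation.Unary.Unique.DecPropositional.Properties as Unique
open import Data.Nat.Base as ℕ using (ℕ; suc; s≤s)
import Data.Nat.Properties as ℕ
open import Data.Product.Base using (∃-syntax; _×_; _,_; proj₂)
open import Data.Rational.Base using (ℚ; mkℚ; 0ℚ; 1ℚ; _≤_; _<_; *≤*; _/_; ↧ₙ_)
import Data.Rational.Properties as ℚ
open import Data.Vec.Functional using (Vector)
open import Function.Bundles using (_⇔_; mk⇔; module Equivalence)
open import Relation.Binary.PropositionalEquality using (_≡_; refl; sym; subst; subst₂; setoid)
open import Relation.Nullary.Decidable using (Dec; _×-dec_)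

-- An element of ℚ is by construction a fraction in reduced form with a positive
-- denominator, so ↧ₙ q is the reduced denominator.
FareyFraction : ℕ → ℚ → Set
FareyFraction n q = 0ℚ ≤ q × q ≤ 1ℚ × ↧ₙ q ℕ.≤ n

record IsFareySequence (n : ℕ) {m : ℕ} (F : Vector ℚ m) : Set where
  field
    increasing : ∀ {i j} → i <ᶠ j → F i < F j
    members    : ∀ q → (∃[ i ] F i ≡ q) ⇔ FareyFraction n q

-- With 0-based indices, opposite i is m - 1 - i; this is the index m + 1 - i
-- when counting from 1.
Palindrome : ∀ {A : Set} {m} → Vector A m → Set
Palindrome v = ∀ i → v i ≡ v (opposite i)

-- The rest shows that IsFareySequence n is inhabited for every n, so that a
-- statement about all sequences satisfying it is not vacuous.
private

  fareyFraction? : ∀ n q → Dec (FareyFraction n q)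
  fareyFraction? n q = (0ℚ ℚ.≤? q) ×-dec (q ℚ.≤? 1ℚ) ×-dec (↧ₙ q ℕ.≤? n)

  candidates : ℕ → List ℚ
  candidates n = cartesianProductWith (λ i j → + i / suc j) (upTo (suc n)) (upTo n)

  candidates-complete : ∀ n q → FareyFraction n q → q ∈ candidates n
  candidates-complete n q@(mkℚ (+ i) j _) (_ , *≤* i≤j , j<n) =
    subst (_∈ candidates n) (ℚ.↥p/↧p≡p q)
      (∈-cartesianProductWith⁺ (λ i j → + i / suc j)
        (∈-upTo⁺ (s≤s (ℕ.≤-trans i≤1+j j<n))) (∈-upTo⁺ j<n))
    where
    i≤1+j : i ℕ.≤ suc j
    i≤1+j = ℤ.drop‿+≤+ (subst₂ ℤ._≤_ (ℤ.*-identityʳ (+ i)) (ℤ.*-identityˡ (+ suc j)) i≤j)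
  candidates-complete n (mkℚ ℤ.-[1+ _ ] _ _) (*≤* () , _)

  open import Data.List.Sort ℚ.≤-decTotalOrder using (sort; sort-↭; sort-↗)

  unsorted : ℕ → List ℚ
  unsorted n = deduplicate ℚ._≟_ (filter (fareyFraction? n) (candidates n))

  farey : ℕ → List ℚ
  farey n = sort (unsorted n)

  farey-increasing : ∀ n → AllPairs _<_ (farey n)
  farey-increasing n = AllPairs.zipWith (λ (p≤q , p≢q) → ℚ.≰⇒> λ q≤p → p≢q (ℚ.≤-antisym p≤q q≤p))
    ( Linked⇒AllPairs ℚ.≤-trans (sort-↗ (unsorted n))
    , Permutation.Unique-resp-↭ (setoid ℚ) (↭⇒↭ₛ (↭-sym (sort-↭ (unsorted n))))
        (Unique.deduplicate-! ℚ._≟_ (filter (fareyFraction? n) (candidates n))))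

  ∈-farey : ∀ n q → q ∈ farey n ⇔ FareyFraction n q
  ∈-farey n q = mk⇔
    (λ q∈ → proj₂ (∈-filter⁻ (fareyFraction? n) {xs = candidates n}
      (∈-deduplicate⁻ ℚ._≟_ _ (∈-resp-↭ (sort-↭ (unsorted n)) q∈))))
    (λ fq → ∈-resp-↭ (↭-sym (sort-↭ (unsorted n)))
      (∈-deduplicate⁺ ℚ._≟_ (∈-filter⁺ (fareyFraction? n) (candidates-complete n q fq) fq)))

  lookup-increasing : ∀ {xs} → AllPairs _<_ xs → ∀ {i j} → i <ᶠ j → lookup xs i < lookup xs j
  lookup-increasing {x ∷ xs} (x<xs ∷ _)  {zero}  {suc j} _         = All.lookup x<xs (∈-lookup j)
  lookup-increasing {x ∷ xs} (_ ∷ pairs) {suc i} {suc j} (s≤s i<j) = lookup-increasing pairs i<j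

fareySequence-exists : ∀ n → ∃[ m ] ∃[ F ] IsFareySequence n {m} F
fareySequence-exists n = length (farey n) , lookup (farey n) , record
  { increasing = lookup-increasing (farey-increasing n)
  ; members    = λ q → mk⇔
      (λ { (i , refl) → to (∈-farey n q) (∈-lookup i) })
      (λ fq → let q∈ = from (∈-farey n q) fq in index q∈ , sym (lookup-index q∈))
  }
  where open Equivalence

{-# OPTIONS --safe #-}

-- The reflection q ↦ 1 - q preserves reduced denominators and maps Fₙ to itself,
-- reversing its order; the only strictly decreasing self-map of a finite chain is i ↦ m - 1 - i.
module Submission where

open import Defs
open import Data.Fin.Base as Fin using (Fin; zero; suc; inject₁; opposite)
import Data.Fin.Properties as Fin
open import Data.Integer.Base as ℤ using (+_)
open import Data.Integer.Divisibility.Signed using (∣ᵤ⇒∣; ∣⇒∣ᵤ; ∣m+n∣m⇒∣n)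
import Data.Integer.Properties as ℤ
open import Data.Integer.Tactic.RingSolver using (solve-∀)
open import Data.Nat.Base as ℕ using (ℕ; suc; _≥_; z≤n)
open import Data.Nat.Coprimality using (Coprime)
import Data.Nat.Divisibility as ℕ
import Data.Nat.Properties as ℕ
open import Data.Product.Base using (_,_; proj₁; proj₂; ∃-syntax)
open import Data.Rational.Base using (ℚ; mkℚ; ↧ₙ_; _≤_; _<_; *≤*; *<*)
import Data.Rational.Properties as ℚ
open import Data.Vec.Functional using (Vector)
open import Function.Base using (_∘_)
open import Function.Bundles using (module Equivalence)
open import Relation.Binary.Definitions using (Monotonic₁; tri<; tri≈; tri>)
open import Relation.Binary.PropositionalEquality
  using (_≡_; refl; sym; cong; subst; subst₂; module ≡-Reasoning)
open import Relation.Nullary.Negation using (contradiction)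

-- If a/b is reduced then so is (b - a)/b, since a common divisor of b - a and b divides a.
-- Completeness of membership in the sequence thus turns q ↦ 1 - q into a self-map `mirror` of the
-- indices with `F (mirror i)` equal to `complement (F i)`, and `mirror` is decreasing because `F`
-- reflects the order. Rigidity of finite chains (`decreasing⇒opposite`) forces `mirror` to be
-- `opposite`, so equal denominators sit at opposite positions.

coprime-complement : ∀ i d → Coprime ℤ.∣ i ∣ d → Coprime ℤ.∣ + d ℤ.- i ∣ d
coprime-complement i d coprime {k} (k∣d-i , k∣d) = coprime (k∣i , k∣d)
  where
  k∣-i = ∣m+n∣m⇒∣n {+ k} {+ d} {ℤ.- i} (∣ᵤ⇒∣ k∣d-i) (∣ᵤ⇒∣ k∣d)
  k∣i  = subst (k ℕ.∣_) (ℤ.∣-i∣≡∣i∣ i) (∣⇒∣ᵤ k∣-i)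

-- 1 - q, built without normalisation so that the denominator is unchanged.
complement : ℚ → ℚ
complement (mkℚ i d-1 coprime) = mkℚ (+ suc d-1 ℤ.- i) d-1 (coprime-complement i (suc d-1) coprime)

↧ₙ-complement : ∀ q → ↧ₙ (complement q) ≡ ↧ₙ q
↧ₙ-complement (mkℚ _ _ _) = refl

private
  -- Cross-multiplied, the two sides of a comparison share the summand `e * d`; the two identities
  -- differ only in the order of that product, so that it can be literally the same term on both
  -- sides.
  complement-* : ∀ i d e → e ℤ.* d ℤ.+ ℤ.- (i ℤ.* e) ≡ (d ℤ.- i) ℤ.* e
  complement-* = solve-∀

  complement-*-comm : ∀ i d e → d ℤ.* e ℤ.+ ℤ.- (i ℤ.* e) ≡ (d ℤ.- i) ℤ.* e
  complement-*-comm = solve-∀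

complement-antimono-≤ : ∀ {p q} → p ≤ q → complement q ≤ complement p
complement-antimono-≤ {mkℚ i d _} {mkℚ j e _} (*≤* p≤q) = *≤*
  (subst₂ ℤ._≤_ (complement-*-comm j (+ suc e) (+ suc d)) (complement-* i (+ suc d) (+ suc e))
    (ℤ.+-monoʳ-≤ (+ suc e ℤ.* + suc d) (ℤ.neg-mono-≤ p≤q)))

complement-antimono-< : ∀ {p q} → p < q → complement q < complement p
complement-antimono-< {mkℚ i d _} {mkℚ j e _} (*<* p<q) = *<*
  (subst₂ ℤ._<_ (complement-*-comm j (+ suc e) (+ suc d)) (complement-* i (+ suc d) (+ suc e))
    (ℤ.+-monoʳ-< (+ suc e ℤ.* + suc d) (ℤ.neg-mono-< p<q)))

complement-fareyFraction : ∀ {n q} → FareyFraction n q → FareyFraction n (complement q)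
complement-fareyFraction {n} {q} (0≤q , q≤1 , ↧q≤n) =
  -- `complement 1ℚ` and `complement 0ℚ` reduce to `0ℚ` and `1ℚ`, the coprimality proofs being
  -- irrelevant.
  complement-antimono-≤ q≤1 ,
  complement-antimono-≤ 0≤q ,
  subst (ℕ._≤ n) (sym (↧ₙ-complement q)) ↧q≤n

StrictlyIncreasing StrictlyDecreasing : ∀ {m n} → (Fin m → Fin n) → Set
StrictlyIncreasing = Monotonic₁ Fin._<_ Fin._<_
StrictlyDecreasing = Monotonic₁ Fin._<_ Fin._>_

-- Induction: i ≤ f(i) < f(i + 1). The recursive call restricts `f` along `inject₁`, which shrinks
-- the domain but not the codomain, so `m` and `n` must vary independently.
increasing⇒inflationary : ∀ {m n} (f : Fin m → Fin n) → StrictlyIncreasing f →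
                          ∀ i → i Fin.≤ f i
increasing⇒inflationary f f-inc zero    = z≤n
increasing⇒inflationary f f-inc (suc i) = ℕ.≤-<-trans
  (increasing⇒inflationary (f ∘ inject₁) (λ j<k → f-inc (inject₁-mono-< j<k)) i)
  (f-inc (Fin.≤̄⇒inject₁< ℕ.≤-refl))
  where
  inject₁-mono-< : StrictlyIncreasing inject₁
  inject₁-mono-< {j} {k} = subst₂ ℕ._<_ (sym (Fin.toℕ-inject₁ j)) (sym (Fin.toℕ-inject₁ k))

opposite-decreasing : ∀ {m} → StrictlyDecreasing (opposite {m})
opposite-decreasing {m} {i} {j} i<j =
  subst₂ ℕ._<_ (sym (Fin.opposite-prop j)) (sym (Fin.opposite-prop i))
    (ℕ.∸-monoʳ-< (ℕ.s≤s i<j) (Fin.toℕ<n j))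

-- Composing `f` with `opposite` on either side gives an increasing, hence inflationary, map. One
-- composite bounds `f i` from below by `opposite i`, the other from above.
decreasing⇒opposite : ∀ {m} (f : Fin m → Fin m) → StrictlyDecreasing f → ∀ i → f i ≡ opposite i
decreasing⇒opposite f f-dec i = Fin.≤-antisym fi≤opp opp≤fi
  where
  opp≤fi : opposite i Fin.≤ f i
  opp≤fi = subst (λ k → opposite i Fin.≤ f k) (Fin.opposite-involutive i)
    (increasing⇒inflationary (f ∘ opposite) (λ j<k → f-dec (opposite-decreasing j<k)) (opposite i))

  i≤opp : i Fin.≤ opposite (f i)
  i≤opp = increasing⇒inflationary (opposite ∘ f) (λ j<k → opposite-decreasing (f-dec j<k)) i

  fi≤opp : f i Fin.≤ opposite i
  -- Applying `opposite` to `opposite i < f i` would give `opposite (f i) < i`, against `i≤opp`.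
  fi≤opp = ℕ.≮⇒≥ λ opp<fi → ℕ.<⇒≱
    (subst (opposite (f i) Fin.<_) (Fin.opposite-involutive i) (opposite-decreasing opp<fi)) i≤opp

increasing⇒reflects-< : ∀ {m} (F : Vector ℚ m) → (∀ {i j} → i Fin.< j → F i < F j) →
                        ∀ {i j} → F i < F j → i Fin.< j
increasing⇒reflects-< F F-inc {i} {j} Fi<Fj with Fin.<-cmp i j
... | tri< i<j _ _  = i<j
... | tri≈ _ refl _ = contradiction Fi<Fj (ℚ.<-irrefl refl)
... | tri> _ _ j<i  = contradiction Fi<Fj (ℚ.<-asym (F-inc j<i))

theorem3p5 : ∀ (n : ℕ) → n ≥ 1 → ∀ {m : ℕ} (F : Vector ℚ m) →
    IsFareySequence n F → Palindrome (↧ₙ_ ∘ F)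
theorem3p5 n _ {m} F isFarey i = begin
  ↧ₙ F i              ≡⟨ ↧ₙ-complement (F i) ⟨
  ↧ₙ complement (F i) ≡⟨ cong ↧ₙ_ (F-mirror i) ⟨
  ↧ₙ F (mirror i)     ≡⟨ cong (↧ₙ_ ∘ F) (decreasing⇒opposite mirror mirror-decreasing i) ⟩
  ↧ₙ F (opposite i)   ∎
  where
  open ≡-Reasoning
  open IsFareySequence isFarey

  mirrored : ∀ i → ∃[ j ] F j ≡ complement (F i)
  mirrored i = Equivalence.from (members (complement (F i)))
    (complement-fareyFraction (Equivalence.to (members (F i)) (i , refl)))

  mirror : Fin m → Fin m
  mirror = proj₁ ∘ mirrored

  F-mirror : ∀ i → F (mirror i) ≡ complement (F i)
  F-mirror = proj₂ ∘ mirrored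

  mirror-decreasing : StrictlyDecreasing mirror
  mirror-decreasing {i} {j} i<j = increasing⇒reflects-< F increasing
    (subst₂ _<_ (sym (F-mirror j)) (sym (F-mirror i)) (complement-antimono-< (increasing i<j)))
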